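{- Let $G$ be a finite simple connected edge transitive graph, let $\mathcal{K}$ be Kemeny's constant for $G$, and let $\{x,y\}$ be an edge of $G$. Then $\dfrac{d\mathcal{K}}{d\{x,y\}}=0$.
   Context: A graph is edge transitive if for every pair of edges $e_1,e_2$ there is a graph automorphism mapping $e_1$ to $e_2$. For a finite simple connected graph $G$ with at least two vertices, $A$ is the adjacency matrix, $d_x$ is the degree of the vertex $x$, $D$ is the diagonal matrix of degrees (invertible), and the normalized Laplacian is $\mathcal{L} = I - D^{ -1/2} A D^{ -1/2}$. Edge derivative of an eigenvalue: let $\lambda$ be an eigenvalue of $\mathcal{L}$ of multiplicity $k$, let $\mathbf{v}_1,\dots,\mathbf{v}_k$ be an orthonormal basis of the $\lambda$-eigenspace, and write $\mathbf{v}_{i,x}$ for the entry of $\mathbf{v}_i$ at the vertex $x$. For a pair $\{x,y\}$ of distinct vertices (adjacent or not), $$\frac{d\lambda}{d\{x,y\}} = \frac1k\sum_{i=1}^k\left[(1-\lambda)\left(\frac{\mathbf{v}_{i,x}^2}{d_x}+\frac{\mathbf{v}_{i,y}^2}{d_y}\right)-2\,\frac{\mathbf{v}_{i,x}\mathbf{v}_{i,y}}{\sqrt{d_xd_y}}\right].$$ This value does not depend on the choice of the orthonormal basis. Kemeny's constant of $G$ is $\mathcal{K}=\mathcal{K}(G)=\sum_{\lambda\ne 0}\frac1\lambda$, the sum being over the nonzero eigenvalues of $\mathcal{L}$ counted with multiplicity, and its edge derivative is $$\frac{d\mathcal{K}}{d\{x,y\}}=\sum_{\lambda\neq 0}-\frac{1}{\lambda^2}\,\frac{d\lambda}{d\{x,y\}},$$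 again over the nonzero eigenvalues counted with multiplicity. -}

module Defs where

open import Level using (_⊔_; 0ℓ) renaming (suc to lsuc)
open import Algebra.Bundles using (CommutativeRing)
open import Algebra.Apartness.Bundles using (HeytingCommutativeRing; HeytingField)
import Algebra.Apartness.Properties.HeytingCommutativeRing as HeytingProperties
import Algebra.Properties.Semiring.Mult as SemiringMult
import Algebra.Properties.Semiring.Sum as SemiringSum
open import Data.Bool.Base using (if_then_else_)
open import Data.Fin.Base using (Fin; zero; suc)
open import Data.Fin.Permutation using (Permutation′; _⟨$⟩ʳ_)
open import Data.Fin.Properties using (_≟_)
open import Data.List.Base using (List; _∷_; length; filter; allFin)
open import Data.List.Membership.Propositional using (_∈_)
open import Data.List.Membership.Propositional.Properties using (∈-filter⁺; ∈-allFin)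
open import Data.Nat.Base as ℕ using (ℕ; zero; suc; s≤s; NonZero)
open import Data.Product.Base using (∃-syntax; Σ-syntax; _×_; _,_; proj₁; proj₂)
open import Data.Sum.Base using (_⊎_; inj₁; inj₂)
open import Data.Vec.Functional using (Vector)
open import Function.Bundles using (_⇔_; Equivalence)
open import Function.Definitions using (Injective)
open import Relation.Binary.Construct.Closure.ReflexiveTransitive using (Star; ε; _◅_)
open import Relation.Binary.Core using (Rel)
open import Relation.Binary.Definitions using (Decidable; Irreflexive; Symmetric)
open import Relation.Binary.PropositionalEquality.Core using (_≡_; _≢_; refl)
open import Relation.Binary.Structures using (IsStrictPartialOrder)
open import Relation.Nullary.Decidable.Core using (does)
open import Relation.Nullary.Negation.Core using (contradiction)

-- The real numbers are described axiomatically, as an Archimedean,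
-- Cauchy-complete ordered field; classically such a field is unique up to
-- unique isomorphism.  The axioms are phrased constructively, so the Bishop
-- (Cauchy) reals are a model without any classical principle.  Since the
-- existential in IsCauchy is a Σ-type, it provides a modulus of convergence.

record RealField c ℓ₁ ℓ₂ ℓ₃ : Set (lsuc (c ⊔ ℓ₁ ⊔ ℓ₂ ⊔ ℓ₃)) where
  infix 4 _<_
  field
    heytingField : HeytingField c ℓ₁ ℓ₂

  open HeytingField heytingField public
  open HeytingCommutativeRing heytingCommutativeRing public using (commutativeRing)
  open CommutativeRing commutativeRing public using (semiring)
  open SemiringSum semiring public using (sum; sum-syntax)
  open SemiringMult semiring public using () renaming (_×_ to _×ᴿ_)

  field
    _<_                  : Rel Carrier ℓ₃
    isStrictPartialOrder : IsStrictPartialOrder _≈_ _<_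
    #⇔<>                 : ∀ {x y} → x # y ⇔ (x < y ⊎ y < x)
    0<1                  : 0# < 1#
    +-monoˡ-<            : ∀ z {x y} → x < y → x + z < y + z
    *-pos                : ∀ {x y} → 0# < x → 0# < y → 0# < x * y
    archimedean          : ∀ x → ∃[ n ] x < n ×ᴿ 1#

  IsCauchy : (ℕ → Carrier) → Set (c ⊔ ℓ₃)
  IsCauchy a = ∀ ε → 0# < ε →
    ∃[ N ] (∀ m n → N ℕ.≤ m → N ℕ.≤ n → a m - a n < ε)

  _ConvergesTo_ : (ℕ → Carrier) → Carrier → Set (c ⊔ ℓ₃)
  a ConvergesTo l = ∀ ε → 0# < ε →
    ∃[ N ] (∀ n → N ℕ.≤ n → (a n - l < ε) × (l - a n < ε))

  -- The existence of square roots is a consequence of the other axioms; it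
  -- is listed so that √ is available as an operation.
  field
    complete   : ∀ a → IsCauchy a → ∃[ l ] a ConvergesTo l
    squareRoot : ∀ {a} → 0# < a → ∃[ r ] (0# < r × r * r ≈ a)

module RealOperations {c ℓ₁ ℓ₂ ℓ₃} (ℝ : RealField c ℓ₁ ℓ₂ ℓ₃) where
  open RealField ℝ
  open IsStrictPartialOrder isStrictPartialOrder
    using () renaming (trans to <-trans; <-respˡ-≈ to <-respˡ; <-respʳ-≈ to <-respʳ)
  open HeytingProperties heytingCommutativeRing public using (x#0y#0→xy#0)

  ℝ⁺ : Set (c ⊔ ℓ₃)
  ℝ⁺ = ∃[ a ] 0# < a

  infixl 7 _·⁺_
  _·⁺_ : ℝ⁺ → ℝ⁺ → ℝ⁺
  (a , 0<a) ·⁺ (b , 0<b) = a * b , *-pos 0<a 0<b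

  √ : ℝ⁺ → ℝ⁺
  √ (a , 0<a) = proj₁ (squareRoot 0<a) , proj₁ (proj₂ (squareRoot 0<a))

  inverse : ∀ a → a # 0# → Carrier
  inverse a a#0 = proj₁ (#⇒invertible a#0)

  infix 8 1/_
  1/_ : ℝ⁺ → Carrier
  1/ (a , 0<a) = inverse a (Equivalence.from #⇔<> (inj₂ 0<a))

  fromℕ-positive : ∀ n .{{_ : NonZero n}} → 0# < n ×ᴿ 1#
  fromℕ-positive (suc zero)      = <-respʳ (sym (+-identityʳ 1#)) 0<1
  fromℕ-positive (suc n@(suc _)) =
    <-trans (fromℕ-positive n)
      (<-respˡ (+-identityˡ (n ×ᴿ 1#)) (+-monoˡ-< (n ×ᴿ 1#) 0<1))

  fromℕ⁺ : ∀ n .{{_ : NonZero n}} → ℝ⁺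
  fromℕ⁺ n = n ×ᴿ 1# , fromℕ-positive n

  Matrix : ℕ → Set c
  Matrix n = Fin n → Fin n → Carrier

  infixl 7 _*ᴹ_ _*ᵛ_
  infixl 6 _-ᴹ_

  _*ᴹ_ : ∀ {n} → Matrix n → Matrix n → Matrix n
  _*ᴹ_ {n} M N x y = ∑[ z < n ] (M x z * N z y)

  _-ᴹ_ : ∀ {n} → Matrix n → Matrix n → Matrix n
  (M -ᴹ N) x y = M x y - N x y

  _*ᵛ_ : ∀ {n} → Matrix n → Vector Carrier n → Vector Carrier n
  _*ᵛ_ {n} M v x = ∑[ y < n ] (M x y * v y)

  diagonal : ∀ {n} → Vector Carrier n → Matrix n
  diagonal d x y = if does (x ≟ y) then d x else 0#

  identity : ∀ {n} → Matrix n
  identity = diagonal (λ _ → 1#)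

  ⟨_,_⟩ : ∀ {n} → Vector Carrier n → Vector Carrier n → Carrier
  ⟨_,_⟩ {n} v w = ∑[ x < n ] (v x * w x)

  Eigenspace : ∀ {n} → Matrix n → Carrier → Vector Carrier n → Set ℓ₁
  Eigenspace M λ′ v = ∀ x → (M *ᵛ v) x ≈ λ′ * v x

  IsEigenvalue : ∀ {n} → Matrix n → Carrier → Set (c ⊔ ℓ₁ ⊔ ℓ₂)
  IsEigenvalue M λ′ = ∃[ v ] ((∃[ x ] v x # 0#) × Eigenspace M λ′ v)

  record IsOrthonormalEigenbasis {n} (M : Matrix n) (λ′ : Carrier)
         {k} (v : Fin k → Vector Carrier n) : Set (c ⊔ ℓ₁) where
    field
      inEigenspace : ∀ i → Eigenspace M λ′ (v i)
      orthonormal  : ∀ i j → ⟨ v i , v j ⟩ ≈ identity i j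
      spanning     : ∀ w → Eigenspace M λ′ w →
                     Σ[ a ∈ Vector Carrier k ] (∀ x → w x ≈ ∑[ i < k ] (a i * v i x))

record SimpleGraph (n : ℕ) : Set₁ where
  field
    Adj    : Rel (Fin n) 0ℓ
    adj?   : Decidable Adj
    sym    : Symmetric Adj
    irrefl : Irreflexive _≡_ Adj

  degree : Fin n → ℕ
  degree x = length (filter (adj? x) (allFin n))

record ConnectedGraph (n : ℕ) : Set₁ where
  field
    simpleGraph : SimpleGraph n

  open SimpleGraph simpleGraph public

  field
    2≤n       : 2 ℕ.≤ n
    connected : ∀ x y → Star Adj x y

  degree-nonZero : ∀ x → NonZero (degree x)
  degree-nonZero x = fromMember (∈-filter⁺ (adj? x) (∈-allFin (proj₁ nbr)) (proj₂ nbr))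
    where
    fromMember : ∀ {y} {ys : List (Fin n)} → y ∈ ys → NonZero (length ys)
    fromMember {ys = _ ∷ _} _ = _

    other : ∀ {m} → 2 ℕ.≤ m → (x : Fin m) → ∃[ y ] x ≢ y
    other (s≤s (s≤s _)) zero    = suc zero , λ ()
    other (s≤s (s≤s _)) (suc _) = zero , λ ()

    firstStep : ∀ {y} → x ≢ y → Star Adj x y → ∃[ z ] Adj x z
    firstStep x≢y ε        = contradiction refl x≢y
    firstStep x≢y (xz ◅ _) = _ , xz

    nbr : ∃[ z ] Adj x z
    nbr = firstStep (proj₂ (other 2≤n x)) (connected x _)

module _ {n} (G : ConnectedGraph n) where
  open ConnectedGraph G

  IsAutomorphism : Permutation′ n → Set
  IsAutomorphism σ = ∀ x y → Adj x y ⇔ Adj (σ ⟨$⟩ʳ x) (σ ⟨$⟩ʳ y)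

  -- Edges are unordered, so an automorphism may map {x,y} to {u,v} in either
  -- of two ways.
  EdgeTransitive : Set
  EdgeTransitive = ∀ {x y u v} → Adj x y → Adj u v →
    ∃[ σ ] (IsAutomorphism σ ×
            ((σ ⟨$⟩ʳ x ≡ u × σ ⟨$⟩ʳ y ≡ v) ⊎ (σ ⟨$⟩ʳ x ≡ v × σ ⟨$⟩ʳ y ≡ u)))

module _ {c ℓ₁ ℓ₂ ℓ₃} (ℝ : RealField c ℓ₁ ℓ₂ ℓ₃) {n} (G : ConnectedGraph n) where
  open RealField ℝ
  open RealOperations ℝ
  open ConnectedGraph G using (Adj; adj?; degree; degree-nonZero)

  adjacency : Matrix n
  adjacency x y = if does (adj? x y) then 1# else 0#

  d : Fin n → ℝ⁺
  d x = fromℕ⁺ (degree x) {{degree-nonZero x}}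

  D^-½ : Matrix n
  D^-½ = diagonal (λ x → 1/ √ (d x))

  normalizedLaplacian : Matrix n
  normalizedLaplacian = identity -ᴹ D^-½ *ᴹ adjacency *ᴹ D^-½

  eigenvalueDerivative : (λ′ : Carrier) (k : ℕ) .{{_ : NonZero k}}
                         (v : Fin k → Vector Carrier n) (x y : Fin n) → Carrier
  eigenvalueDerivative λ′ k v x y =
    1/ fromℕ⁺ k *
    ∑[ i < k ] ( (1# - λ′) * (v i x * v i x * 1/ d x + v i y * v i y * 1/ d y)
               - (1# + 1#) * (v i x * v i y * 1/ √ (d x ·⁺ d y)))

  -- The nonzero eigenvalues, each distinct one listed once, with an
  -- orthonormal basis of each eigenspace.  Such a list is unique up to order
  -- and the choice of bases, which is why it suffices to evaluate sums over
  -- the nonzero eigenvalues on one.  The zero eigenvalue is left out so that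
  -- no zero test on reals is needed.
  record NonzeroSpectrum : Set (c ⊔ ℓ₁ ⊔ ℓ₂) where
    field
      size         : ℕ
      eigenvalue   : Fin size → Carrier
      nonzero      : ∀ j → eigenvalue j # 0#
      distinct     : Injective _≡_ _≈_ eigenvalue
      exhaustive   : ∀ μ → μ # 0# → IsEigenvalue normalizedLaplacian μ →
                     ∃[ j ] μ ≈ eigenvalue j
      multiplicity : Fin size → ℕ
      -- Together with the existence of a basis, this says that eigenvalue j
      -- is indeed an eigenvalue.
      multiplicity-nonZero : ∀ j → NonZero (multiplicity j)
      basis        : ∀ j → Fin (multiplicity j) → Vector Carrier n
      isBasis      : ∀ j → IsOrthonormalEigenbasis normalizedLaplacian
                             (eigenvalue j) (basis j)

    -- Σ_{λ≠0} f λ with multiplicity, i.e. the term of each distinct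
    -- eigenvalue is added as many times as its multiplicity.
    sumWithMultiplicity : (Fin size → Carrier) → Carrier
    sumWithMultiplicity f = ∑[ j < size ] (multiplicity j ×ᴿ f j)

    kemeny : Carrier
    kemeny = sumWithMultiplicity λ j → inverse (eigenvalue j) (nonzero j)

    kemenyDerivative : Fin n → Fin n → Carrier
    kemenyDerivative x y = sumWithMultiplicity λ j →
      - inverse (eigenvalue j * eigenvalue j) (x#0y#0→xy#0 (nonzero j) (nonzero j))
      * eigenvalueDerivative (eigenvalue j) (multiplicity j)
          {{multiplicity-nonZero j}} (basis j) x y

{-# OPTIONS --safe #-}

-- For a single eigenvalue λ the edge derivative already vanishes.  Let P be
-- the orthogonal projection onto the λ-eigenspace.  Up to the factor 1/k the
-- derivative is Φ x y = h x y + h y x, where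
-- h x y = (1 - λ) P x x / d x - P x y / √(d x d y).  Since the columns of P are
-- eigenvectors of D^-½ A D^-½ for 1 - λ, the sum of h x y over the neighbours y
-- of x is zero, so Φ sums to zero over all edges.  Automorphisms preserve P,
-- and hence Φ, so Φ is constant on edges and must be zero.

module Submission where

open import Defs
open import Algebra.Bundles using (CommutativeRing)
import Algebra.Apartness.Properties.HeytingCommutativeRing as HeytingProperties
import Algebra.Properties.AbelianGroup as AbelianGroupProperties
import Algebra.Properties.CommutativeSemigroup as CommutativeSemigroupProperties
import Algebra.Properties.Ring as RingProperties
import Algebra.Properties.Semiring.Mult as SemiringMult
import Algebra.Properties.Semiring.Sum as SemiringSum
import Algebra.Solver.Ring.NaturalCoefficients.Default as SemiringSolver
open import Data.Bool.Base using (true; false; if_then_else_)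
open import Data.Fin.Base using (Fin; zero; suc)
open import Data.Fin.Permutation
  using (Permutation′; _⟨$⟩ʳ_; _⟨$⟩ˡ_; inverseˡ; inverseʳ; flip)
open import Data.Fin.Properties using (_≟_)
open import Data.List.Base using (length; filter; tabulate)
open import Data.Nat.Base using (ℕ; zero; suc; NonZero)
open import Data.Product.Base using (_,_; proj₁; proj₂)
open import Data.Sum.Base using (inj₁; inj₂)
open import Data.Vec.Functional using (Vector)
open import Function.Base using (_∘_)
open import Function.Bundles using (mk⇔)
open import Level using (Level; _⊔_)
import Relation.Binary.PropositionalEquality as ≡
open ≡ using (_≡_)
import Relation.Binary.Reasoning.Setoid as SetoidReasoning
open import Relation.Binary.Structures using (IsStrictPartialOrder)
open import Relation.Nullary.Decidable using (does; does-⇔; yes; no)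
open import Relation.Unary using (Pred; Decidable)

-- Real arithmetic: inverses, square roots and finite sums.

module RealProperties {c ℓ₁ ℓ₂ ℓ₃} (ℝ : RealField c ℓ₁ ℓ₂ ℓ₃) where
  open RealField ℝ hiding (zero)
  open RealOperations ℝ
  open IsStrictPartialOrder isStrictPartialOrder
    using () renaming (trans to <-trans; <-respˡ-≈ to <-respˡ; <-respʳ-≈ to <-respʳ)
  open CommutativeRing commutativeRing public
    using (ring; commutativeSemiring; +-abelianGroup; +-commutativeSemigroup)
  open HeytingProperties heytingCommutativeRing using (x-0≈x)
  open AbelianGroupProperties +-abelianGroup public
    using () renaming (x∙y⁻¹≈ε⇒x≈y to x-y≈0⇒x≈y; ⁻¹-∙-comm to -‿+-comm)
  open RingProperties ring public using (x[y-z]≈xy-xz; [y-z]x≈yx-zx; -0#≈0#)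
  open SemiringSum semiring public
    using (sum-cong-≋; sum-replicate; sum-replicate-zero; *-distribˡ-sum; *-distribʳ-sum;
           ∑-distrib-+; ∑-comm; ∑-permute)
  open SemiringSolver commutativeSemiring public using (solve; _:+_; _:*_; _:=_; con)
  open SetoidReasoning setoid

  +-pos : ∀ {x y} → 0# < x → 0# < y → 0# < x + y
  +-pos {x} {y} 0<x 0<y =
    <-trans 0<y (<-respˡ (+-identityˡ y) (+-monoˡ-< y 0<x))

  inverse-inverseˡ : ∀ a a#0 → inverse a a#0 * a ≈ 1#
  inverse-inverseˡ a a#0 =
    -- Invertibility derived from `a # 0#` concerns the difference `a - 0#`, which must first be
    -- replaced by `a`.
    trans (*-congˡ (sym (x-0≈x a))) (proj₁ (proj₂ (#⇒invertible a#0)))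

  1/-inverseˡ : ∀ a → 1/ a * proj₁ a ≈ 1#
  1/-inverseˡ (a , 0<a) = inverse-inverseˡ a _

  -- The inverse chosen by `1/_` depends on the positivity proof carried by its argument. Uniqueness
  -- removes this dependence and yields congruence and multiplicativity of `1/_`.
  1/-unique : ∀ a {b} → b * proj₁ a ≈ 1# → 1/ a ≈ b
  1/-unique a⁺@(a , _) {b} ba≈1 = begin
    1/ a⁺             ≈⟨ *-identityˡ (1/ a⁺) ⟨
    1# * 1/ a⁺        ≈⟨ *-congʳ ba≈1 ⟨
    b * a * 1/ a⁺     ≈⟨ solve 3 (λ x y z → x :* y :* z := x :* (z :* y)) refl b a (1/ a⁺) ⟩
    b * (1/ a⁺ * a)   ≈⟨ *-congˡ (1/-inverseˡ a⁺) ⟩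
    b * 1#            ≈⟨ *-identityʳ b ⟩
    b                 ∎

  1/-cong : ∀ {a b : ℝ⁺} → proj₁ a ≈ proj₁ b → 1/ a ≈ 1/ b
  1/-cong {a} {b} a≈b = 1/-unique a (trans (*-congˡ a≈b) (1/-inverseˡ b))

  pos-*-cancelˡ-0 : ∀ {a b} → 0# < a → a * b ≈ 0# → b ≈ 0#
  pos-*-cancelˡ-0 {a} {b} 0<a ab≈0 = begin
    b                       ≈⟨ *-identityˡ b ⟨
    1# * b                  ≈⟨ *-congʳ (1/-inverseˡ (a , 0<a)) ⟨
    1/ (a , 0<a) * a * b    ≈⟨ *-assoc _ a b ⟩
    1/ (a , 0<a) * (a * b)  ≈⟨ *-congˡ ab≈0 ⟩
    1/ (a , 0<a) * 0#       ≈⟨ zeroʳ _ ⟩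
    0#                      ∎

  √-square : ∀ a → proj₁ (√ a) * proj₁ (√ a) ≈ proj₁ a
  √-square (_ , 0<a) = proj₂ (proj₂ (squareRoot 0<a))

  -- Let s be the chosen root. Then (s + r)(s - r) = s² - r² = 0, and s + r is positive, hence
  -- cancellable. This shows that the root, chosen from a positivity proof, respects `≈` and
  -- products.
  √-unique : ∀ a {r} → 0# < r → r * r ≈ proj₁ a → proj₁ (√ a) ≈ r
  √-unique a {r} 0<r rr≈a =
    x-y≈0⇒x≈y s r (pos-*-cancelˡ-0 (+-pos (proj₂ (√ a)) 0<r) (begin
      (s + r) * (s - r)              ≈⟨ x[y-z]≈xy-xz (s + r) s r ⟩
      (s + r) * s - (s + r) * r      ≈⟨ +-cong (distribʳ s s r) (-‿cong (distribʳ r s r)) ⟩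
      (s * s + r * s) - (s * r + r * r)
        ≈⟨ +-cong (+-cong (√-square a) (*-comm r s)) (-‿cong (+-congˡ rr≈a)) ⟩
      (proj₁ a + s * r) - (s * r + proj₁ a)
        ≈⟨ +-congʳ (+-comm (proj₁ a) (s * r)) ⟩
      (s * r + proj₁ a) - (s * r + proj₁ a)
        ≈⟨ -‿inverseʳ _ ⟩
      0#                             ∎))
    where s = proj₁ (√ a)

  √-cong : ∀ {a b : ℝ⁺} → proj₁ a ≈ proj₁ b → proj₁ (√ a) ≈ proj₁ (√ b)
  √-cong {a} {b} a≈b =
    √-unique a (proj₂ (√ b)) (trans (√-square b) (sym a≈b))

  √-homo-· : ∀ a b → proj₁ (√ (a ·⁺ b)) ≈ proj₁ (√ a) * proj₁ (√ b)
  √-homo-· a b = √-unique (a ·⁺ b) (*-pos (proj₂ (√ a)) (proj₂ (√ b))) (begin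
    r * s * (r * s)    ≈⟨ solve 2 (λ r s → r :* s :* (r :* s) := r :* r :* (s :* s)) refl r s ⟩
    r * r * (s * s)    ≈⟨ *-cong (√-square a) (√-square b) ⟩
    proj₁ a * proj₁ b  ∎)
    where
    r = proj₁ (√ a)
    s = proj₁ (√ b)

  -- The product appears as any `c⁺` of the right value, because the lemma is meant for
  -- `√ (a ·⁺ b)`, which is only `≈` to the product of the two roots.
  1/-homo-· : ∀ a b {c⁺ : ℝ⁺} → proj₁ c⁺ ≈ proj₁ a * proj₁ b → 1/ c⁺ ≈ 1/ a * 1/ b
  1/-homo-· a⁺@(a , _) b⁺@(b , _) {c⁺} c≈ab = 1/-unique c⁺ (begin
    1/ a⁺ * 1/ b⁺ * proj₁ c⁺     ≈⟨ *-congˡ c≈ab ⟩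
    1/ a⁺ * 1/ b⁺ * (a * b)
      ≈⟨ solve 4 (λ p q a b → p :* q :* (a :* b) := p :* a :* (q :* b)) refl (1/ a⁺) (1/ b⁺) a b ⟩
    1/ a⁺ * a * (1/ b⁺ * b)      ≈⟨ *-cong (1/-inverseˡ a⁺) (1/-inverseˡ b⁺) ⟩
    1# * 1#                      ≈⟨ *-identityʳ 1# ⟩
    1#                           ∎)

  sum-zero : ∀ {n} {f : Vector Carrier n} → (∀ i → f i ≈ 0#) → sum f ≈ 0#
  sum-zero {n} f≈0 = trans (sum-cong-≋ f≈0) (sum-replicate-zero n)

  sum-neg : ∀ {n} (f : Vector Carrier n) → ∑[ i < n ] (- f i) ≈ - sum f
  sum-neg {zero}  f = sym -0#≈0#
  sum-neg {suc n} f = trans (+-congˡ (sum-neg (f ∘ suc))) (-‿+-comm (f zero) (sum (f ∘ suc)))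

  ∑-distrib-- : ∀ {n} (f g : Vector Carrier n) →
                ∑[ i < n ] (f i - g i) ≈ sum f - sum g
  ∑-distrib-- f g = trans (∑-distrib-+ f (λ i → - g i)) (+-congˡ (sum-neg g))

  -- The argument of type `Fin n` rules out the empty sum, which would be zero.
  sum-pos : ∀ {n} → Fin n → (f : Vector Carrier n) → (∀ i → 0# < f i) → 0# < sum f
  sum-pos {suc zero}    _ f 0<f = <-respʳ (sym (+-identityʳ (f zero))) (0<f zero)
  sum-pos {suc (suc n)} _ f 0<f = +-pos (0<f zero) (sum-pos zero (f ∘ suc) (0<f ∘ suc))

  sum-diagonalˡ : ∀ {n} d x (f : Vector Carrier n) → ∑[ y < n ] (diagonal d x y * f y) ≈ d x * f x
  sum-diagonalˡ {suc n} d zero f =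
    trans (+-congˡ (sum-zero (λ y → zeroˡ (f (suc y))))) (+-identityʳ (d zero * f zero))
  sum-diagonalˡ {suc n} d (suc x) f =
    -- The recursive call fits because `diagonal d (suc x) (suc y)` computes to
    -- `diagonal (d ∘ suc) x y`.
    trans (+-cong (zeroˡ (f zero)) (sum-diagonalˡ (d ∘ suc) x (f ∘ suc))) (+-identityˡ _)

  sum-identity : ∀ {n} x (f : Vector Carrier n) → ∑[ y < n ] (identity x y * f y) ≈ f x
  sum-identity x f = trans (sum-diagonalˡ (λ _ → 1#) x f) (*-identityˡ (f x))

  sum-diagonalʳ : ∀ {n} d y (f : Vector Carrier n) → ∑[ x < n ] (f x * diagonal d x y) ≈ f y * d y
  sum-diagonalʳ {suc n} d zero f =
    trans (+-congˡ (sum-zero (λ x → zeroʳ (f (suc x))))) (+-identityʳ (f zero * d zero))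
  sum-diagonalʳ {suc n} d (suc y) f =
    trans (+-cong (zeroʳ (f zero)) (sum-diagonalʳ (d ∘ suc) y (f ∘ suc))) (+-identityˡ _)

  -- This turns the degree, a list length, into a row sum of the adjacency matrix. The general `f`
  -- lets the induction pass from `f` to `f ∘ suc`; `allFin n` is the case of the identity.
  length-filter-tabulate : ∀ {a p} {A : Set a} {P : Pred A p} (P? : Decidable P)
    {n} (f : Fin n → A) →
    length (filter P? (tabulate f)) ×ᴿ 1# ≈ ∑[ i < n ] (if does (P? (f i)) then 1# else 0#)
  length-filter-tabulate P? {zero}  f = refl
  length-filter-tabulate P? {suc n} f with does (P? (f zero))
  ... | true  = +-congˡ (length-filter-tabulate P? (f ∘ suc))
  ... | false = trans (length-filter-tabulate P? (f ∘ suc)) (sym (+-identityˡ _))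

-- Eigenspaces and their orthogonal projections.

module EigenspaceProperties {c ℓ₁ ℓ₂ ℓ₃} (ℝ : RealField c ℓ₁ ℓ₂ ℓ₃) {n : ℕ} where
  open RealField ℝ hiding (zero)
  open RealOperations ℝ
  open RealProperties ℝ
  open SetoidReasoning setoid

  private variable
    M K K′ : Matrix n
    μ : Carrier

  projection : ∀ {k} → (Fin k → Vector Carrier n) → Matrix n
  projection {k} v x y = ∑[ i < k ] (v i x * v i y)

  -- This describes the matrix of the orthogonal projection onto the `μ`-eigenspace without a basis,
  -- so that symmetry arguments never have to compare two bases.
  record IsReproducingKernel (M : Matrix n) (μ : Carrier) (K : Matrix n) : Set (c ⊔ ℓ₁) where
    field
      symmetric    : ∀ x y → K x y ≈ K y x
      inEigenspace : ∀ y → Eigenspace M μ (λ x → K x y)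
      reproducing  : ∀ w → Eigenspace M μ w → ∀ x → ∑[ y < n ] (K x y * w y) ≈ w x

  open IsReproducingKernel

  -- Reproduction of columns gives K′ K = K and K K′ = K′. Since both kernels are symmetric,
  -- transposing the first equation gives K K′ = K, so they agree.
  reproducingKernel-unique : IsReproducingKernel M μ K → IsReproducingKernel M μ K′ →
                             ∀ x y → K x y ≈ K′ x y
  reproducingKernel-unique {K = K} {K′ = K′} isK isK′ x y = begin
    K x y                        ≈⟨ reproducing isK′ _ (inEigenspace isK y) x ⟨
    ∑[ z < n ] (K′ x z * K z y)  ≈⟨ sum-cong-≋ (λ z → trans (*-comm (K′ x z) (K z y))
                                      (*-cong (symmetric isK z y) (symmetric isK′ x z))) ⟩
    ∑[ z < n ] (K y z * K′ z x)  ≈⟨ reproducing isK _ (inEigenspace isK′ x) y ⟩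
    K′ y x                       ≈⟨ symmetric isK′ y x ⟩
    K′ x y                       ∎

  -- Each column is a combination of the vectors `v i`, hence stays in the eigenspace. Applied to w,
  -- the matrix returns the sum of `⟨ v i , w ⟩` times `v i`, and orthonormality identifies these
  -- inner products with the coefficients of w given by `spanning`.
  projection-reproducing : ∀ {k} {v : Fin k → Vector Carrier n} →
    IsOrthonormalEigenbasis M μ v → IsReproducingKernel M μ (projection v)
  projection-reproducing {M = M} {μ = μ} {k = k} {v = v} isBasis = record
    { symmetric    = λ x y → sum-cong-≋ (λ i → *-comm (v i x) (v i y))
    ; inEigenspace = λ y x → begin
        ∑[ z < n ] (M x z * projection v z y)
          ≈⟨ sum-cong-≋ (λ z → *-distribˡ-sum (M x z) (λ i → v i z * v i y)) ⟩
        ∑[ z < n ] ∑[ i < k ] (M x z * (v i z * v i y))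
          ≈⟨ ∑-comm (λ z i → M x z * (v i z * v i y)) ⟩
        ∑[ i < k ] ∑[ z < n ] (M x z * (v i z * v i y))
          ≈⟨ sum-cong-≋ (λ i → begin
               ∑[ z < n ] (M x z * (v i z * v i y))  ≈⟨ sum-cong-≋ (λ z → *-assoc (M x z) (v i z) (v i y)) ⟨
               ∑[ z < n ] (M x z * v i z * v i y)    ≈⟨ *-distribʳ-sum (v i y) (λ z → M x z * v i z) ⟨
               (M *ᵛ v i) x * v i y                  ≈⟨ *-congʳ (B.inEigenspace i x) ⟩
               μ * v i x * v i y                     ≈⟨ *-assoc μ (v i x) (v i y) ⟩
               μ * (v i x * v i y)                   ∎) ⟩
        ∑[ i < k ] (μ * (v i x * v i y))
          ≈⟨ *-distribˡ-sum μ (λ i → v i x * v i y) ⟨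
        μ * projection v x y ∎
    ; reproducing  = λ w w∈E x → let (a , w≈∑av) = B.spanning w w∈E in begin
        ∑[ y < n ] (projection v x y * w y)
          ≈⟨ sum-cong-≋ (λ y → *-distribʳ-sum (w y) (λ i → v i x * v i y)) ⟩
        ∑[ y < n ] ∑[ i < k ] (v i x * v i y * w y)
          ≈⟨ ∑-comm (λ y i → v i x * v i y * w y) ⟩
        ∑[ i < k ] ∑[ y < n ] (v i x * v i y * w y)
          ≈⟨ sum-cong-≋ (λ i → begin
               ∑[ y < n ] (v i x * v i y * w y)    ≈⟨ sum-cong-≋ (λ y → *-assoc (v i x) (v i y) (w y)) ⟩
               ∑[ y < n ] (v i x * (v i y * w y))  ≈⟨ *-distribˡ-sum (v i x) (λ y → v i y * w y) ⟨
               v i x * ⟨ v i , w ⟩                 ≈⟨ *-congˡ (coordinate a w≈∑av i) ⟩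
               v i x * a i                         ≈⟨ *-comm (v i x) (a i) ⟩
               a i * v i x                         ∎) ⟩
        ∑[ i < k ] (a i * v i x)
          ≈⟨ w≈∑av x ⟨
        w x ∎
    }
    where
    module B = IsOrthonormalEigenbasis isBasis

    coordinate : ∀ {w} (a : Vector Carrier k) → (∀ x → w x ≈ ∑[ i < k ] (a i * v i x)) →
                 ∀ i → ⟨ v i , w ⟩ ≈ a i
    coordinate {w} a w≈∑av i = begin
      ∑[ y < n ] (v i y * w y)
        ≈⟨ sum-cong-≋ (λ y → trans (*-congˡ (w≈∑av y)) (*-distribˡ-sum (v i y) (λ j → a j * v j y))) ⟩
      ∑[ y < n ] ∑[ j < k ] (v i y * (a j * v j y))
        ≈⟨ ∑-comm (λ y j → v i y * (a j * v j y)) ⟩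
      ∑[ j < k ] ∑[ y < n ] (v i y * (a j * v j y))
        ≈⟨ sum-cong-≋ (λ j → begin
             ∑[ y < n ] (v i y * (a j * v j y))
               ≈⟨ sum-cong-≋ (λ y → solve 3 (λ p a q → p :* (a :* q) := p :* q :* a) refl (v i y) (a j) (v j y)) ⟩
             ∑[ y < n ] (v i y * v j y * a j)   ≈⟨ *-distribʳ-sum (a j) (λ y → v i y * v j y) ⟨
             ⟨ v i , v j ⟩ * a j                ≈⟨ *-congʳ (B.orthonormal i j) ⟩
             identity i j * a j                 ∎) ⟩
      ∑[ j < k ] (identity i j * a j)
        ≈⟨ sum-identity i a ⟩
      a i ∎

  -- Permutations acting on matrices, eigenspaces and kernels.

  Invariant : Permutation′ n → Matrix n → Set ℓ₁
  Invariant σ M = ∀ x y → M (σ ⟨$⟩ʳ x) (σ ⟨$⟩ʳ y) ≈ M x y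

  invariant-flip : ∀ σ → Invariant σ M → Invariant (flip σ) M
  invariant-flip {M = M} σ inv x y = begin
    M (σ ⟨$⟩ˡ x) (σ ⟨$⟩ˡ y)                        ≈⟨ inv _ _ ⟨
    M (σ ⟨$⟩ʳ (σ ⟨$⟩ˡ x)) (σ ⟨$⟩ʳ (σ ⟨$⟩ˡ y))      ≡⟨ ≡.cong₂ M (inverseʳ σ) (inverseʳ σ) ⟩
    M x y                                          ∎

  -- Invariance says that M commutes with the permutation matrix of σ, which therefore preserves
  -- each eigenspace; concretely, the sum is reindexed along σ.
  eigenspace-permute : ∀ σ → Invariant σ M → ∀ w → Eigenspace M μ w →
                       Eigenspace M μ (w ∘ (σ ⟨$⟩ʳ_))
  eigenspace-permute {M = M} {μ = μ} σ inv w w∈E x = begin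
    ∑[ y < n ] (M x y * w (σ ⟨$⟩ʳ y))                      ≈⟨ sum-cong-≋ (λ y → *-congʳ (inv x y)) ⟨
    ∑[ y < n ] (M (σ ⟨$⟩ʳ x) (σ ⟨$⟩ʳ y) * w (σ ⟨$⟩ʳ y))    ≈⟨ ∑-permute (λ y → M (σ ⟨$⟩ʳ x) y * w y) σ ⟨
    ∑[ y < n ] (M (σ ⟨$⟩ʳ x) y * w y)                      ≈⟨ w∈E (σ ⟨$⟩ʳ x) ⟩
    μ * w (σ ⟨$⟩ʳ x)                                       ∎

  reproducingKernel-permute : ∀ σ → Invariant σ M → IsReproducingKernel M μ K →
    IsReproducingKernel M μ (λ x y → K (σ ⟨$⟩ʳ x) (σ ⟨$⟩ʳ y))
  reproducingKernel-permute {M = M} {K = K} σ inv isK = record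
    { symmetric    = λ x y → symmetric isK _ _
    ; inEigenspace = λ y → eigenspace-permute σ inv _ (inEigenspace isK (σ ⟨$⟩ʳ y))
    ; reproducing  = λ w w∈E x → begin
        ∑[ y < n ] (K (σ ⟨$⟩ʳ x) (σ ⟨$⟩ʳ y) * w y)
          -- Writing w y as w (σ⁻¹ (σ y)) makes the sum a reindexing along σ. What remains is the
          -- reproducing property of K at σ x for w ∘ σ⁻¹, which lies in the eigenspace because M is
          -- invariant under σ⁻¹ too.
          ≈⟨ sum-cong-≋ {n} (λ y → *-congˡ (reflexive (≡.cong w (inverseˡ σ {y})))) ⟨
        ∑[ y < n ] (K (σ ⟨$⟩ʳ x) (σ ⟨$⟩ʳ y) * w (σ ⟨$⟩ˡ (σ ⟨$⟩ʳ y)))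
          ≈⟨ ∑-permute (λ y → K (σ ⟨$⟩ʳ x) y * w (σ ⟨$⟩ˡ y)) σ ⟨
        ∑[ y < n ] (K (σ ⟨$⟩ʳ x) y * w (σ ⟨$⟩ˡ y))
          ≈⟨ reproducing isK _ (eigenspace-permute (flip σ) (invariant-flip σ inv) w w∈E) (σ ⟨$⟩ʳ x) ⟩
        w (σ ⟨$⟩ˡ (σ ⟨$⟩ʳ x))
          ≡⟨ ≡.cong w (inverseˡ σ) ⟩
        w x ∎
    }

  -- Permuting K by σ gives a kernel of the same eigenspace, and such a kernel is unique.
  reproducingKernel-invariant : ∀ σ → Invariant σ M → IsReproducingKernel M μ K → Invariant σ K
  reproducingKernel-invariant σ inv isK =
    reproducingKernel-unique (reproducingKernel-permute σ inv isK) isK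

  identity-invariant : ∀ σ → Invariant σ identity
  identity-invariant σ x y = reflexive (≡.cong (if_then 1# else 0#)
    (does-⇔ (mk⇔ injective (≡.cong (σ ⟨$⟩ʳ_))) (_ ≟ _) (x ≟ y)))
    where
    injective : σ ⟨$⟩ʳ x ≡ σ ⟨$⟩ʳ y → x ≡ y
    injective eq = ≡.trans (≡.sym (inverseˡ σ)) (≡.trans (≡.cong (σ ⟨$⟩ˡ_) eq) (inverseˡ σ))

-- Entries and eigenvectors of the normalized Laplacian.

module LaplacianProperties {c ℓ₁ ℓ₂ ℓ₃} (ℝ : RealField c ℓ₁ ℓ₂ ℓ₃) {n} (G : ConnectedGraph n) where
  open RealField ℝ hiding (zero)
  open RealOperations ℝ
  open RealProperties ℝ
  open EigenspaceProperties ℝ {n}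
  open IsReproducingKernel
  open ConnectedGraph G using (Adj; adj?) renaming (sym to Adj-sym)
  open SetoidReasoning setoid

  private
    A : Matrix n
    A = adjacency ℝ G

    L : Matrix n
    L = normalizedLaplacian ℝ G

    deg : Fin n → Carrier
    deg x = proj₁ (d ℝ G x)

    deg⁻¹ deg^-½ : Fin n → Carrier
    deg⁻¹  x = 1/ d ℝ G x
    deg^-½ x = 1/ √ (d ℝ G x)

  adjacency-sym : ∀ x y → A x y ≈ A y x
  adjacency-sym x y =
    reflexive (≡.cong (if_then 1# else 0#) (does-⇔ (mk⇔ Adj-sym Adj-sym) (adj? x y) (adj? y x)))

  deg≈∑adjacency : ∀ x → deg x ≈ ∑[ y < n ] A x y
  deg≈∑adjacency x = length-filter-tabulate (adj? x) (λ y → y)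

  normalizedAdjacency : ∀ x y →
    (D^-½ ℝ G *ᴹ A *ᴹ D^-½ ℝ G) x y ≈ deg^-½ x * A x y * deg^-½ y
  normalizedAdjacency x y =
    trans (sum-diagonalʳ deg^-½ y ((D^-½ ℝ G *ᴹ A) x))
          (*-congʳ (sum-diagonalˡ deg^-½ x (λ z → A z y)))

  laplacian-entry : ∀ x y → L x y ≈ identity x y - deg^-½ x * A x y * deg^-½ y
  laplacian-entry x y = +-congˡ (-‿cong (normalizedAdjacency x y))

  -- With N the normalized adjacency matrix, L = I - N. The sum S is the entry (N w) x, recovered as
  -- w x - (w x - S), where w x - S = (L w) x = μ w x.
  eigenspace⇒normalizedAdjacency : ∀ {μ} w → Eigenspace L μ w → ∀ x →
    ∑[ y < n ] (deg^-½ x * A x y * deg^-½ y * w y) ≈ (1# - μ) * w x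
  eigenspace⇒normalizedAdjacency {μ} w w∈E x = begin
    S                   ≈⟨ +-identityˡ S ⟨
    0# + S              ≈⟨ +-congʳ (-‿inverseʳ (w x)) ⟨
    w x - w x + S       ≈⟨ +-assoc (w x) (- w x) S ⟩
    w x + (- w x + S)   ≈⟨ +-congˡ (begin
      - w x + S             ≈⟨ +-congˡ (⁻¹-involutive S) ⟨
      - w x + - (- S)       ≈⟨ -‿+-comm (w x) (- S) ⟩
      - (w x - S)           ≈⟨ -‿cong wx-S≈μwx ⟩
      - (μ * w x)           ∎) ⟩
    w x - μ * w x       ≈⟨ +-congʳ (*-identityˡ (w x)) ⟨
    1# * w x - μ * w x  ≈⟨ [y-z]x≈yx-zx (w x) 1# μ ⟨
    (1# - μ) * w x      ∎
    where
    open AbelianGroupProperties +-abelianGroup using (⁻¹-involutive)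
    N : Fin n → Carrier
    N y = deg^-½ x * A x y * deg^-½ y
    S = ∑[ y < n ] (N y * w y)

    wx-S≈μwx : w x - S ≈ μ * w x
    wx-S≈μwx = begin
      w x - S                                     ≈⟨ +-congʳ (sum-identity x w) ⟨
      ∑[ y < n ] (identity x y * w y) - S         ≈⟨ ∑-distrib-- (λ y → identity x y * w y) (λ y → N y * w y) ⟨
      ∑[ y < n ] (identity x y * w y - N y * w y)
        ≈⟨ sum-cong-≋ (λ y → trans (*-congʳ (laplacian-entry x y)) ([y-z]x≈yx-zx (w y) (identity x y) (N y))) ⟨
      (L *ᵛ w) x                                  ≈⟨ w∈E x ⟩
      μ * w x                                     ∎

  -- Invariance of degrees and Laplacian under graph automorphisms.

  module _ (σ : Permutation′ n) (isAut : IsAutomorphism G σ) where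

    adjacency-invariant : Invariant σ A
    adjacency-invariant x y = reflexive (≡.cong (if_then 1# else 0#)
      (≡.sym (does-⇔ (isAut x y) (adj? x y) (adj? _ _))))

    deg-invariant : ∀ x → deg (σ ⟨$⟩ʳ x) ≈ deg x
    deg-invariant x = begin
      deg (σ ⟨$⟩ʳ x)                        ≈⟨ deg≈∑adjacency _ ⟩
      -- As a row sum, the degree only needs its row reindexed along σ; no neighbour lists are
      -- compared.
      ∑[ y < n ] A (σ ⟨$⟩ʳ x) y             ≈⟨ ∑-permute (A (σ ⟨$⟩ʳ x)) σ ⟩
      ∑[ y < n ] A (σ ⟨$⟩ʳ x) (σ ⟨$⟩ʳ y)    ≈⟨ sum-cong-≋ (adjacency-invariant x) ⟩
      ∑[ y < n ] A x y                      ≈⟨ deg≈∑adjacency x ⟨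
      deg x                                 ∎

    deg⁻¹-invariant : ∀ x → deg⁻¹ (σ ⟨$⟩ʳ x) ≈ deg⁻¹ x
    deg⁻¹-invariant x = 1/-cong {d ℝ G (σ ⟨$⟩ʳ x)} {d ℝ G x} (deg-invariant x)

    deg^-½-invariant : ∀ x → deg^-½ (σ ⟨$⟩ʳ x) ≈ deg^-½ x
    deg^-½-invariant x = 1/-cong {√ (d ℝ G (σ ⟨$⟩ʳ x))} {√ (d ℝ G x)}
      (√-cong {d ℝ G (σ ⟨$⟩ʳ x)} {d ℝ G x} (deg-invariant x))

    laplacian-invariant : Invariant σ L
    laplacian-invariant x y = begin
      L (σ ⟨$⟩ʳ x) (σ ⟨$⟩ʳ y)                        ≈⟨ laplacian-entry _ _ ⟩
      _                                              ≈⟨ +-cong (identity-invariant σ x y) (-‿cong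
                                                          (*-cong (*-cong (deg^-½-invariant x) (adjacency-invariant x y))
                                                                  (deg^-½-invariant y))) ⟩
      identity x y - deg^-½ x * A x y * deg^-½ y     ≈⟨ laplacian-entry x y ⟨
      L x y                                          ∎

  -- The edge derivative as a function of the kernel.

  halfDerivative : Carrier → Matrix n → Matrix n
  halfDerivative μ K x y =
    (1# - μ) * (K x x * deg⁻¹ x) - K x y * (deg^-½ x * deg^-½ y)

  derivative : Carrier → Matrix n → Matrix n
  derivative μ K x y = halfDerivative μ K x y + halfDerivative μ K y x

  derivative-sym : ∀ μ K x y → derivative μ K x y ≈ derivative μ K y x
  derivative-sym μ K x y = +-comm (halfDerivative μ K x y) (halfDerivative μ K y x)

  -- Linearity in the kernel: the rank-one contributions of the basis vectors add up to that of the
  -- projection.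
  halfDerivative-∑ : ∀ μ {k} (K : Fin k → Matrix n) x y →
    ∑[ i < k ] halfDerivative μ (K i) x y ≈
    halfDerivative μ (λ x y → ∑[ i < k ] K i x y) x y
  halfDerivative-∑ μ {k} K x y = begin
    ∑[ i < k ] ((1# - μ) * (K i x x * t) - K i x y * q)
      ≈⟨ ∑-distrib-- (λ i → (1# - μ) * (K i x x * t)) (λ i → K i x y * q) ⟩
    ∑[ i < k ] ((1# - μ) * (K i x x * t)) - ∑[ i < k ] (K i x y * q)
      ≈⟨ +-cong (trans (*-congˡ (*-distribʳ-sum t (λ i → K i x x))) (*-distribˡ-sum (1# - μ) (λ i → K i x x * t)))
                (-‿cong (*-distribʳ-sum q (λ i → K i x y))) ⟨
    (1# - μ) * (∑[ i < k ] K i x x * t) - ∑[ i < k ] K i x y * q ∎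
    where
    t = deg⁻¹ x
    q = deg^-½ x * deg^-½ y

  eigenvalueDerivative≈derivative : ∀ μ k .{{_ : NonZero k}} (v : Fin k → Vector Carrier n) x y →
    eigenvalueDerivative ℝ G μ k v x y ≈ 1/ fromℕ⁺ k * derivative μ (projection v) x y
  eigenvalueDerivative≈derivative μ k v x y = *-congˡ (begin
    _ ≈⟨ sum-cong-≋ term ⟩
    ∑[ i < k ] (halfDerivative μ (P i) x y + halfDerivative μ (P i) y x)
      ≈⟨ ∑-distrib-+ (λ i → halfDerivative μ (P i) x y) (λ i → halfDerivative μ (P i) y x) ⟩
    ∑[ i < k ] halfDerivative μ (P i) x y + ∑[ i < k ] halfDerivative μ (P i) y x
      ≈⟨ +-cong (halfDerivative-∑ μ P x y) (halfDerivative-∑ μ P y x) ⟩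
    derivative μ (projection v) x y ∎)
    where
    open CommutativeSemigroupProperties +-commutativeSemigroup using (interchange)

    P : Fin k → Matrix n
    P i x y = v i x * v i y

    term : ∀ i →
      (1# - μ) * (P i x x * deg⁻¹ x + P i y y * deg⁻¹ y)
        - (1# + 1#) * (P i x y * 1/ √ (d ℝ G x ·⁺ d ℝ G y))
      ≈ halfDerivative μ (P i) x y + halfDerivative μ (P i) y x
    term i = begin
      (1# - μ) * (P i x x * deg⁻¹ x + P i y y * deg⁻¹ y)
        - (1# + 1#) * (P i x y * 1/ √ (d ℝ G x ·⁺ d ℝ G y))
        ≈⟨ +-cong (distribˡ (1# - μ) _ _) (-‿cong (begin
             (1# + 1#) * (P i x y * 1/ √ (d ℝ G x ·⁺ d ℝ G y))
               ≈⟨ *-congˡ (*-congˡ (1/-homo-· (√ (d ℝ G x)) (√ (d ℝ G y)) {√ (d ℝ G x ·⁺ d ℝ G y)}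
                    (√-homo-· (d ℝ G x) (d ℝ G y)))) ⟩
             (1# + 1#) * (P i x y * (deg^-½ x * deg^-½ y))
               -- The factor 2 is split into one cross term for each order of the endpoints.
               ≈⟨ solve 4 (λ p q r s → (con 1 :+ con 1) :* (p :* q :* (r :* s))
                                       := p :* q :* (r :* s) :+ q :* p :* (s :* r))
                    refl (v i x) (v i y) (deg^-½ x) (deg^-½ y) ⟩
             b + b′ ∎)) ⟩
      a + a′ - (b + b′)         ≈⟨ +-congˡ (-‿+-comm b b′) ⟨
      a + a′ + (- b + - b′)     ≈⟨ interchange a a′ (- b) (- b′) ⟩
      a - b + (a′ - b′)         ∎
      where
      a  = (1# - μ) * (P i x x * deg⁻¹ x)
      a′ = (1# - μ) * (P i y y * deg⁻¹ y)
      b  = P i x y * (deg^-½ x * deg^-½ y)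
      b′ = P i y x * (deg^-½ y * deg^-½ x)

  -- Vanishing of the edge derivative for the kernel of an eigenspace.

  module _ {μ K} (isK : IsReproducingKernel L μ K) where

    -- Both parts sum to `(1# - μ) * K x x`. In the first, the number of neighbours cancels 1/d x;
    -- the second is the entry at x of the normalized adjacency matrix applied to column x of K.
    ∑-neighbours-halfDerivative : ∀ x → ∑[ y < n ] (A x y * halfDerivative μ K x y) ≈ 0#
    ∑-neighbours-halfDerivative x = begin
      ∑[ y < n ] (A x y * (a - b y))            ≈⟨ sum-cong-≋ (λ y → x[y-z]≈xy-xz (A x y) a (b y)) ⟩
      ∑[ y < n ] (A x y * a - A x y * b y)      ≈⟨ ∑-distrib-- (λ y → A x y * a) (λ y → A x y * b y) ⟩
      ∑[ y < n ] (A x y * a) - ∑[ y < n ] (A x y * b y)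
                                                ≈⟨ +-cong ∑Aa (-‿cong ∑Ab) ⟩
      (1# - μ) * K x x - (1# - μ) * K x x       ≈⟨ -‿inverseʳ _ ⟩
      0#                                        ∎
      where
      a = (1# - μ) * (K x x * deg⁻¹ x)
      b : Fin n → Carrier
      b y = K x y * (deg^-½ x * deg^-½ y)

      ∑Aa : ∑[ y < n ] (A x y * a) ≈ (1# - μ) * K x x
      ∑Aa = begin
        ∑[ y < n ] (A x y * a)                  ≈⟨ *-distribʳ-sum a (A x) ⟨
        ∑[ y < n ] A x y * a                    ≈⟨ *-congʳ (deg≈∑adjacency x) ⟨
        deg x * a                               ≈⟨ solve 4 (λ δ m κ t → δ :* (m :* (κ :* t)) := m :* (κ :* (t :* δ)))
                                                     refl (deg x) (1# - μ) (K x x) (deg⁻¹ x) ⟩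
        (1# - μ) * (K x x * (deg⁻¹ x * deg x))  ≈⟨ *-congˡ (*-congˡ (1/-inverseˡ (d ℝ G x))) ⟩
        (1# - μ) * (K x x * 1#)                 ≈⟨ *-congˡ (*-identityʳ (K x x)) ⟩
        (1# - μ) * K x x                        ∎

      ∑Ab : ∑[ y < n ] (A x y * b y) ≈ (1# - μ) * K x x
      ∑Ab = begin
        ∑[ y < n ] (A x y * b y)
          -- Symmetry of K turns its row at x into its column at x, which lies in the eigenspace.
          ≈⟨ sum-cong-≋ (λ y → trans (*-congˡ (*-congʳ (symmetric isK x y)))
               (solve 4 (λ α κ r s → α :* (κ :* (r :* s)) := r :* α :* s :* κ)
                  refl (A x y) (K y x) (deg^-½ x) (deg^-½ y))) ⟩
        ∑[ y < n ] (deg^-½ x * A x y * deg^-½ y * K y x)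
          ≈⟨ eigenspace⇒normalizedAdjacency _ (inEigenspace isK x) x ⟩
        (1# - μ) * K x x ∎

    -- The sum runs over ordered pairs, so each edge counts twice. Exchanging the summations and
    -- using the symmetry of A brings the part with h y x to the form of the part with h x y.
    ∑-edges-derivative : ∑[ x < n ] ∑[ y < n ] (A x y * derivative μ K x y) ≈ 0#
    ∑-edges-derivative = begin
      ∑[ x < n ] ∑[ y < n ] (A x y * (h x y + h y x))
        ≈⟨ sum-cong-≋ (λ x → trans (sum-cong-≋ (λ y → distribˡ (A x y) (h x y) (h y x)))
             (∑-distrib-+ (λ y → A x y * h x y) (λ y → A x y * h y x))) ⟩
      ∑[ x < n ] (∑[ y < n ] (A x y * h x y) + ∑[ y < n ] (A x y * h y x))
        ≈⟨ ∑-distrib-+ (λ x → ∑[ y < n ] (A x y * h x y)) (λ x → ∑[ y < n ] (A x y * h y x)) ⟩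
      ∑[ x < n ] ∑[ y < n ] (A x y * h x y) + ∑[ x < n ] ∑[ y < n ] (A x y * h y x)
        ≈⟨ +-cong (sum-zero ∑-neighbours-halfDerivative) (begin
             ∑[ x < n ] ∑[ y < n ] (A x y * h y x)
               ≈⟨ ∑-comm (λ x y → A x y * h y x) ⟩
             ∑[ y < n ] ∑[ x < n ] (A x y * h y x)
               ≈⟨ sum-cong-≋ (λ y → sum-cong-≋ (λ x → *-congʳ (adjacency-sym x y))) ⟩
             ∑[ y < n ] ∑[ x < n ] (A y x * h y x)
               ≈⟨ sum-zero ∑-neighbours-halfDerivative ⟩
             0# ∎) ⟩
      0# + 0#  ≈⟨ +-identityˡ 0# ⟩
      0#       ∎
      where
      h = halfDerivative μ K

    derivative-invariant : ∀ σ → IsAutomorphism G σ → Invariant σ (derivative μ K)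
    derivative-invariant σ isAut x y = +-cong (half x y) (half y x)
      where
      K-invariant : Invariant σ K
      K-invariant = reproducingKernel-invariant σ (laplacian-invariant σ isAut) isK

      half : Invariant σ (halfDerivative μ K)
      half x y = +-cong
        (*-congˡ (*-cong (K-invariant x x) (deg⁻¹-invariant σ isAut x)))
        (-‿cong (*-cong (K-invariant x y)
          (*-cong (deg^-½-invariant σ isAut x) (deg^-½-invariant σ isAut y))))

    module _ (edgeTransitive : EdgeTransitive G) {x y} (xy : Adj x y) where

      derivative-constant : ∀ {u v} → Adj u v → derivative μ K u v ≈ derivative μ K x y
      derivative-constant {u} {v} uv with edgeTransitive xy uv
      ... | σ , isAut , inj₁ (≡.refl , ≡.refl) = derivative-invariant σ isAut x y
      -- Here σ reverses the orientation of the edge, which the symmetry of the derivative absorbs.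
      ... | σ , isAut , inj₂ (≡.refl , ≡.refl) =
        trans (derivative-sym μ K u v) (derivative-invariant σ isAut x y)

      -- The common value on edges, multiplied by the sum of all degrees, is the vanishing sum over
      -- ordered edges. The degree sum is positive and cancels.
      derivative≈0 : derivative μ K x y ≈ 0#
      derivative≈0 = pos-*-cancelˡ-0 (sum-pos x deg (λ u → proj₂ (d ℝ G u))) (begin
        sum deg * c₀
          ≈⟨ *-distribʳ-sum c₀ deg ⟩
        ∑[ u < n ] (deg u * c₀)
          ≈⟨ sum-cong-≋ (λ u → trans (*-congʳ (deg≈∑adjacency u)) (*-distribʳ-sum c₀ (A u))) ⟩
        ∑[ u < n ] ∑[ v < n ] (A u v * c₀)
          ≈⟨ sum-cong-≋ (λ u → sum-cong-≋ (λ v → A*c₀ u v)) ⟩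
        ∑[ u < n ] ∑[ v < n ] (A u v * derivative μ K u v)
          ≈⟨ ∑-edges-derivative ⟩
        0# ∎)
        where
        c₀ = derivative μ K x y

        A*c₀ : ∀ u v → A u v * c₀ ≈ A u v * derivative μ K u v
        A*c₀ u v with adj? u v
        ... | yes uv = *-congˡ (sym (derivative-constant uv))
        -- Off the edges the derivative need not equal `c₀`, but the factor `A u v` is zero.
        ... | no  _  = trans (zeroˡ c₀) (sym (zeroˡ _))

theorem3p2 : ∀ {c ℓ₁ ℓ₂ ℓ₃ : Level} (ℝ : RealField c ℓ₁ ℓ₂ ℓ₃) {n : ℕ} (G : ConnectedGraph n) →
    EdgeTransitive G →
    (S : NonzeroSpectrum ℝ G) (x y : Fin n) → ConnectedGraph.Adj G x y →
    RealField._≈_ ℝ (NonzeroSpectrum.kemenyDerivative S x y) (RealField.0# ℝ)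
theorem3p2 ℝ G edgeTransitive S x y xy = sum-zero λ j →
  trans (×-congʳ (multiplicity j) (trans (*-congˡ (eigenvalueDerivative≈0 j)) (zeroʳ _)))
        -- A natural multiple of zero is read as a constant sum of zeros.
        (trans (sym (sum-replicate (multiplicity j))) (sum-replicate-zero (multiplicity j)))
  where
  open RealField ℝ hiding (zero)
  open RealProperties ℝ
  open EigenspaceProperties ℝ
  open LaplacianProperties ℝ G
  open NonzeroSpectrum S
  open SemiringMult semiring using (×-congʳ)

  eigenvalueDerivative≈0 : ∀ j →
    eigenvalueDerivative ℝ G (eigenvalue j) (multiplicity j) {{multiplicity-nonZero j}} (basis j) x y ≈ 0#
  eigenvalueDerivative≈0 j = let instance _ = multiplicity-nonZero j in
    trans (eigenvalueDerivative≈derivative (eigenvalue j) (multiplicity j) (basis j) x y)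
      (trans (*-congˡ (derivative≈0 (projection-reproducing (isBasis j)) edgeTransitive xy)) (zeroʳ _))
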